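{- Let $m\ge n \ge 2$ be integers. Then $$a_1(P_n \,\square\, P_m) = \begin{cases} 2; & (n = 2 \text{ and } 2 \le m \le 5), \text{ or } (n=3 \text{ and } m\in\{3,4\}),\\ 3; & (n = 2 \text{ and } m \ge 6), \text{ or } (n=3 \text{ and } 5 \le m \le 11), \text{ or } (n=4 \text{ and } 4 \le m \le 7), \text{ or } n=m=5,\\ 4; & \text{otherwise}, \end{cases}$$ and $$a_1'(P_n \,\square\, P_m) = \begin{cases} 2; & n=m=2,\\ 3; & n=2,\ m \ge 3,\\ 4; & m\ge n \ge 3. \end{cases}$$
   Context: $P_n$ is the path on $n$ vertices. The Cartesian product $G\,\square\, H$ of graphs $G$ and $H$ has vertex set $V(G)\times V(H)$, with $(g,h)$ and $(g',h')$ adjacent if either $gg'\in E(G)$ and $h=h'$, or $g=g'$ and $hh'\in E(H)$. A clique of a graph $G$ is an inclusion-wise maximal complete subgraph. The $(a,b)$-monochromatic clique transversal game ($(a,b)$-MCT game) on $G$ is played by Alice and Bob, who alternately take turns: in each of her turns Alice chooses $a$ unplayed vertices and colors them red, and in each of his turns Bob chooses $b$ unplayed vertices and colors them blue (if fewer unplayed vertices remain, the player colors all of them). Alice wins if the red vertices contain at least one vertex of each clique of $G$; Bob wins if all vertices of some clique of $G$ are blue. The game is Alice-start or Bob-start depending on who moves first. The threshold $a_1(G)$ (resp. $a_1'(G)$) is the smallest positive integer $a$ such that Alice has a winning strategy in the Alice-start (resp. Bob-start) $(a,1)$-MCT game on $G$. -}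

module Defs where

open import Data.Fin using (Fin; toℕ)
open import Data.List using (List; []; _++_; length)
open import Data.List.Membership.Propositional using (_∈_; _∉_)
open import Data.List.Relation.Binary.Subset.Propositional using (_⊆_)
open import Data.List.Relation.Unary.All using (All)
open import Data.List.Relation.Unary.Unique.Propositional using (Unique)
open import Data.Nat using (ℕ; suc; _≤_; _<_)
open import Data.Nat.Properties using (1+n≢n)
open import Data.Product using (_×_; _,_; ∃-syntax)
open import Data.Sum using (_⊎_; inj₁; inj₂; swap)
open import Relation.Nullary using (¬_)
open import Relation.Binary.PropositionalEquality using (_≡_; _≢_; sym)

record Graph : Set₁ where
  field
    Vertex     : Set
    Adj        : Vertex → Vertex → Set
    Adj-sym    : ∀ {u v} → Adj u v → Adj v u
    Adj-irrefl : ∀ {v} → ¬ Adj v v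

open Graph public

P : ℕ → Graph
P n = record
  { Vertex     = Fin n
  ; Adj        = λ i j → suc (toℕ i) ≡ toℕ j ⊎ suc (toℕ j) ≡ toℕ i
  ; Adj-sym    = swap
  ; Adj-irrefl = λ { (inj₁ eq) → 1+n≢n eq ; (inj₂ eq) → 1+n≢n eq }
  }

infixr 7 _□_

_□_ : Graph → Graph → Graph
G □ H = record
  { Vertex     = Vertex G × Vertex H
  ; Adj        = λ { (g , h) (g′ , h′) →
                     (Adj G g g′ × h ≡ h′) ⊎ (g ≡ g′ × Adj H h h′) }
  ; Adj-sym    = λ { (inj₁ (e , q)) → inj₁ (Adj-sym G e , sym q)
                   ; (inj₂ (q , e)) → inj₂ (sym q , Adj-sym H e) }
  ; Adj-irrefl = λ { (inj₁ (e , _)) → Adj-irrefl G e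
                   ; (inj₂ (_ , e)) → Adj-irrefl H e }
  }

-- Graphs are meant to be finite: a set of vertices is represented by a list
-- enumerating it, with order and repetitions irrelevant.  A complete subgraph
-- is identified with its vertex set.

Complete : (G : Graph) → List (Vertex G) → Set
Complete G K = ∀ {u v} → u ∈ K → v ∈ K → u ≢ v → Adj G u v

Clique : (G : Graph) → List (Vertex G) → Set
Clique G K = Complete G K × (∀ L → Complete G L → K ⊆ L → L ⊆ K)

record Position (G : Graph) : Set where
  constructor position
  field
    red  : List (Vertex G)
    blue : List (Vertex G)

open Position public

start : ∀ {G} → Position G
start = position [] []

Unplayed : ∀ {G} → Position G → Vertex G → Set
Unplayed p v = v ∉ red p × v ∉ blue p

-- `xs` is a legal choice for a player who colours k vertices per turn: exactly
-- k distinct unplayed vertices, or all of them when fewer than k remain.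
record Move {G : Graph} (k : ℕ) (p : Position G) (xs : List (Vertex G)) : Set where
  field
    distinct : Unique xs
    unplayed : All (Unplayed p) xs
    amount   : length xs ≡ k ⊎ (length xs < k × (∀ v → Unplayed p v → v ∈ xs))

colourRed colourBlue : ∀ {G} → List (Vertex G) → Position G → Position G
colourRed  xs p = position (xs ++ red p) (blue p)
colourBlue xs p = position (red p) (xs ++ blue p)

RedTransversal : (G : Graph) → Position G → Set
RedTransversal G p = ∀ K → Clique G K → ∃[ v ] (v ∈ K × v ∈ red p)

data Player : Set where
  alice bob : Player

-- AliceWins G a b t p: Alice has a winning strategy in the (a,b)-game on G from
-- position p with player t to move.  An inhabitant is a strategy tree: one
-- move at each turn of Alice, a reply to every legal move at each turn of Bob,
-- every branch ending with Alice's goal reached.  A win of Bob needs no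
-- constructor: vertices are never recoloured, so once some clique is all blue
-- `won` is out of reach.  Since leaves are only of the form `won`, and a
-- player facing a full board still has the empty move, Alice cannot win
-- by exhausting the board.
data AliceWins (G : Graph) (a b : ℕ) : Player → Position G → Set where
  won        : ∀ {t p} → RedTransversal G p → AliceWins G a b t p
  aliceMoves : ∀ {p} xs → Move a p xs →
               AliceWins G a b bob (colourRed xs p) →
               AliceWins G a b alice p
  bobMoves   : ∀ {p} →
               (∀ xs → Move b p xs → AliceWins G a b alice (colourBlue xs p)) →
               AliceWins G a b bob p

SmallestPositive : (ℕ → Set) → ℕ → Set
SmallestPositive Q k = 1 ≤ k × Q k × (∀ j → 1 ≤ j → Q j → k ≤ j)

-- The thresholds are given as relations: a₁ G k and a₁′ G k say that the
-- threshold of the Alice-start, resp. Bob-start, (a,1)-game on G equals k.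

a₁ : Graph → ℕ → Set
a₁ G = SmallestPositive (λ a → AliceWins G a 1 alice start)

a₁′ : Graph → ℕ → Set
a₁′ G = SmallestPositive (λ a → AliceWins G a 1 bob start)

{-# OPTIONS --safe #-}
-- The cliques of a grid are its edges.  If after Alice's first turn some
-- unplayed vertex v has more than a unplayed neighbours, Bob plays v and then a
-- neighbour of v that Alice left over, completing a blue edge.  Otherwise Alice
-- wins by always colouring every unplayed neighbour of Bob's last vertex.  So
-- the Bob-start threshold is the maximum degree, and the Alice-start threshold
-- is the least a such that deleting some a vertices leaves maximum degree at
-- most a.  Deletions restrict to subgrids, so only the minimal bad and the
-- maximal good grids have to be examined, by a finite computation.
module Submission where

open import Defs
open import Data.Empty using (⊥-elim)
open import Data.Fin using (Fin; toℕ; fromℕ<)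
open import Data.Fin.Properties using (toℕ<n; toℕ-injective; toℕ-fromℕ<)
import Data.Fin.Properties as Fin
open import Data.List using (List; []; _∷_; _++_; length; filter; map; take; upTo; allFin; cartesianProduct)
open import Data.List.Properties using (++-identityʳ; length-++; length-map; length-take; length-filter; take-all)
open import Data.List.Membership.Propositional using (_∈_; _∉_; find)
open import Data.List.Membership.Propositional.Properties
  using (∈-++⁺ˡ; ∈-++⁺ʳ; ∈-++⁻; ∈-map⁺; ∈-map⁻; ∈-filter⁺; ∈-filter⁻;
         ∈-upTo⁺; ∈-upTo⁻; ∈-allFin; ∈-length;
         ∈-cartesianProduct⁺; ∈-cartesianProduct⁻)
import Data.List.Membership.DecPropositional as DecMembership
open import Data.List.Relation.Binary.Subset.Propositional using (_⊆_)
open import Data.List.Relation.Unary.All as All using (All; []; _∷_)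
open import Data.List.Relation.Unary.AllPairs using ([]; _∷_)
open import Data.List.Relation.Unary.Any as Any using (Any; here; there)
open import Data.List.Relation.Unary.Unique.Propositional using (Unique)
import Data.List.Relation.Unary.Unique.Propositional.Properties as Uniqueₚ
open import Data.Nat using (ℕ; zero; suc; _+_; _∸_; _⊓_; _≤_; _<_; z≤n; s≤s; s≤s⁻¹; _≤?_; _<?_; parity)
open import Data.Nat.Properties
open import Data.Parity using (Parity; _⁻¹)
open import Data.Parity.Properties using (p≢p⁻¹; ⁻¹-involutive; suc-homo-⁻¹)
open import Data.Product using (_×_; _,_; proj₁; proj₂; ∃-syntax; map₂)
open import Data.Product.Properties using (≡-dec)
open import Data.Sum using (_⊎_; inj₁; inj₂; [_,_]′)
import Data.Sum as Sum
open import Data.Unit using (tt)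
open import Function using (_∘_)
open import Relation.Binary using (DecidableEquality)
open import Relation.Binary.PropositionalEquality using (_≡_; _≢_; refl; sym; trans; cong; cong₂; subst; subst₂; ≢-sym)
open import Relation.Nullary using (¬_; Dec; yes; no; contradiction; _×-dec_; _⊎-dec_)
open import Relation.Nullary.Decidable using (toWitness)

-- Counting with duplicate-free lists

module _ {A : Set} where

  -- Only one occurrence is removed, so the length drops by exactly one. This is the decreasing
  -- measure in the pigeonhole argument, in Alice's strategy and in the search for stars.
  delete : ∀ {x : A} {ys} → x ∈ ys →
           ∃[ zs ] (length ys ≡ suc (length zs) × (∀ {y} → y ∈ ys → y ≢ x → y ∈ zs))
  delete {ys = _ ∷ zs} (here refl) =
    zs , refl , λ { (here y≡x) y≢x → contradiction y≡x y≢x ; (there y∈) _ → y∈ }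
  delete {ys = y ∷ _} (there x∈) with delete x∈
  ... | zs , eq , keep =
    y ∷ zs , cong suc eq , λ { (here y≡) _ → here y≡ ; (there y∈) y≢x → there (keep y∈ y≢x) }

  unique-⊆⇒length≤ : ∀ {xs ys : List A} → Unique xs → xs ⊆ ys → length xs ≤ length ys
  unique-⊆⇒length≤ [] _ = z≤n
  unique-⊆⇒length≤ (x∉xs ∷ xs!) xs⊆ys with delete (xs⊆ys (here refl))
  ... | zs , eq , keep = subst (_ ≤_) (sym eq)
    (s≤s (unique-⊆⇒length≤ xs! λ y∈ → keep (xs⊆ys (there y∈)) (≢-sym (All.lookup x∉xs y∈))))

  pigeonhole : DecidableEquality A → ∀ {xs ys : List A} → Unique xs → length ys < length xs →
               ∃[ x ] (x ∈ xs × x ∉ ys)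
  pigeonhole _≟_ {xs} {ys} xs! ys<xs with Any.any? (_∉? ys) xs
    where open DecMembership _≟_ using (_∉?_)
  ... | yes found = find found
  ... | no none = contradiction (unique-⊆⇒length≤ xs! xs⊆ys) (<⇒≱ ys<xs)
    where
    open DecMembership _≟_ using (_∈?_)
    xs⊆ys : xs ⊆ ys
    xs⊆ys {x} x∈xs with x ∈? ys
    ... | yes x∈ys = x∈ys
    ... | no x∉ys = contradiction (Any.map (λ { refl → x∉ys }) x∈xs) none

-- Cliques of a triangle-free graph

TriangleFree : Graph → Set
TriangleFree G = ∀ {u v w} → Adj G u v → Adj G v w → ¬ Adj G u w

module _ (G : Graph) (_≟_ : DecidableEquality (Vertex G)) where

  edge-complete : ∀ {u v} → Adj G u v → Complete G (u ∷ v ∷ [])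
  edge-complete uv (here refl) (here refl) u≢u = contradiction refl u≢u
  edge-complete uv (here refl) (there (here refl)) _ = uv
  edge-complete uv (there (here refl)) (here refl) _ = Adj-sym G uv
  edge-complete uv (there (here refl)) (there (here refl)) v≢v = contradiction refl v≢v

  -- A further vertex of a complete set containing the edge would be adjacent to both ends and close
  -- a triangle.
  edge-clique : TriangleFree G → ∀ {u v} → Adj G u v → Clique G (u ∷ v ∷ [])
  edge-clique triangleFree {u} {v} uv = edge-complete uv , maximal
    where
    maximal : ∀ L → Complete G L → (u ∷ v ∷ []) ⊆ L → L ⊆ (u ∷ v ∷ [])
    maximal L complete uv⊆L {w} w∈L with w ≟ u | w ≟ v
    ... | yes refl | _ = here refl
    ... | _ | yes refl = there (here refl)
    ... | no w≢u | no w≢v =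
      contradiction (complete (uv⊆L (here refl)) w∈L (≢-sym w≢u))
        (triangleFree uv (complete (uv⊆L (there (here refl))) w∈L (≢-sym w≢v)))

-- Positions lost for Alice

module _ (G : Graph) {a : ℕ} where

  -- Induction on the strategy tree: Alice cannot recolour blue vertices, and at Bob's turn any
  -- legal move keeps the clique blue, so it is enough to exhibit one.
  blue-clique-lost : ∀ {K t p} → Clique G K → (∀ {w} → w ∈ K → w ∈ blue p × w ∉ red p) →
                     ¬ AliceWins G a 1 t p
  blue-clique-lost clique bad (won meets) with meets _ clique
  ... | _ , v∈K , v∈red = proj₂ (bad v∈K) v∈red
  blue-clique-lost {K} {p = p} clique bad (aliceMoves xs move wins) = blue-clique-lost clique bad′ wins
    where
    bad′ : ∀ {w} → w ∈ K → w ∈ blue p × w ∉ xs ++ red p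
    bad′ w∈K = proj₁ (bad w∈K) , λ w∈ →
      [ (λ w∈xs → proj₂ (All.lookup (Move.unplayed move) w∈xs) (proj₁ (bad w∈K))) , proj₂ (bad w∈K) ]′ (∈-++⁻ xs w∈)
  blue-clique-lost {K} {p = p} clique bad (bobMoves wins) =
    blue-clique-lost clique bad (wins [] pass)
    where
    -- If some `v` were unplayed, Bob's move `v` would already give the contradiction by induction.
    -- So the board is full and the empty move is legal.
    full : ∀ v → ¬ Unplayed p v
    full v v-free = blue-clique-lost clique (λ w∈K → there (proj₁ (bad w∈K)) , proj₂ (bad w∈K))
      (wins (v ∷ []) record { distinct = [] ∷ [] ; unplayed = v-free ∷ [] ; amount = inj₁ refl })
    pass : Move 1 p []
    pass = record { distinct = [] ; unplayed = [] ; amount = inj₂ (s≤s z≤n , λ v v-free → contradiction v-free (full v)) }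

  -- Bob plays `v`, Alice's reply misses some `t` in `T`, and Bob plays `t`. At each earlier stage
  -- the tree might also end in `won`; an edge from `v` into `T` with no red end rules this out.
  overload-lost : DecidableEquality (Vertex G) → TriangleFree G → ∀ {p v T} →
                  Unplayed p v → Unique T → a < length T →
                  (∀ {t} → t ∈ T → Adj G v t × Unplayed p t) → ¬ AliceWins G a 1 bob p
  overload-lost _≟_ triangleFree {p} {v} {T} v-free T! a<T T-free = lost
    where
    edge : ∀ {t} → t ∈ T → Clique G (v ∷ t ∷ [])
    edge t∈T = edge-clique G _≟_ triangleFree (proj₁ (T-free t∈T))

    not-covered : ∀ q {t} → t ∈ T → v ∉ red q → t ∉ red q → ¬ RedTransversal G q
    not-covered q t∈T v∉ t∉ meets with meets _ (edge t∈T)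
    ... | _ , here refl , v∈ = v∉ v∈
    ... | _ , there (here refl) , t∈ = t∉ t∈

    some-t : ∃[ t ] t ∈ T
    some-t = map₂ proj₁ (pigeonhole _≟_ {ys = []} T! (≤-trans (s≤s z≤n) a<T))

    not-yet : ∀ ys → ¬ RedTransversal G (position (red p) ys)
    not-yet ys = not-covered (position (red p) ys) (proj₂ some-t)
      (proj₁ v-free) (proj₁ (proj₂ (T-free (proj₂ some-t))))

    afterAlice : ∀ xs → Move a (colourBlue (v ∷ []) p) xs →
                 ¬ AliceWins G a 1 bob (colourRed xs (colourBlue (v ∷ []) p))
    afterAlice xs move = second
      where
      xs≤a : length xs ≤ a
      xs≤a = [ ≤-reflexive , <⇒≤ ∘ proj₁ ]′ (Move.amount move)

      missed : ∃[ t ] (t ∈ T × t ∉ xs)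
      missed = pigeonhole _≟_ T! (≤-<-trans xs≤a a<T)

      t = proj₁ missed
      t∈T = proj₁ (proj₂ missed)
      t-free = proj₂ (T-free t∈T)

      v∉ : v ∉ xs ++ red p
      v∉ v∈ =
        [ (λ v∈xs → proj₂ (All.lookup (Move.unplayed move) v∈xs) (here refl)) , proj₁ v-free ]′ (∈-++⁻ xs v∈)

      t∉ : t ∉ xs ++ red p
      t∉ t∈ = [ proj₂ (proj₂ missed) , proj₁ t-free ]′ (∈-++⁻ xs t∈)

      t∉blue : t ∉ v ∷ blue p
      t∉blue (here t≡v) = Adj-irrefl G (subst (Adj G v) t≡v (proj₁ (T-free t∈T)))
      t∉blue (there t∈) = proj₂ t-free t∈

      second : ¬ AliceWins G a 1 bob (position (xs ++ red p) (v ∷ blue p))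
      second (won meets) = not-covered (position (xs ++ red p) (v ∷ blue p)) t∈T v∉ t∉ meets
      second (bobMoves wins) = blue-clique-lost (edge t∈T)
        (λ { (here refl) → there (here refl) , v∉ ; (there (here refl)) → here refl , t∉ })
        (wins (t ∷ []) record { distinct = [] ∷ [] ; unplayed = (t∉ , t∉blue) ∷ [] ; amount = inj₁ refl })

    lost : ¬ AliceWins G a 1 bob p
    lost (won meets) = not-yet (blue p) meets
    lost (bobMoves wins) with wins (v ∷ [])
      record { distinct = [] ∷ [] ; unplayed = v-free ∷ [] ; amount = inj₁ refl }
    ... | won meets = not-yet (v ∷ blue p) meets
    ... | aliceMoves xs move wins′ = afterAlice xs move wins′

-- Alice's strategy of answering next to Bob

Sparse : (G : Graph) → ℕ → List (Vertex G) → Set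
Sparse G a S = ∀ v → v ∈ S ⊎ ∃[ N ] (length N ≤ a × (∀ {w} → Adj G v w → w ∈ S ⊎ w ∈ N))

module _ (G : Graph) {a : ℕ} (_≟_ : DecidableEquality (Vertex G))
         {V : List (Vertex G)} (V! : Unique V) (∈V : ∀ v → v ∈ V) where

  open DecMembership _≟_ using (_∈?_; _∉?_)

  -- A move must have an exact size, so the unplayed members of `N` are filled up with other
  -- unplayed vertices.
  moveOnto : ∀ (p : Position G) N → length N ≤ a →
             ∃[ xs ] (Move a p xs × (∀ {v} → Unplayed p v → v ∈ N → v ∈ xs))
  moveOnto p N N≤a = xs , record { distinct = xs! ; unplayed = All.tabulate xs-free ; amount = amount } , onto
    where
    U first rest xs : List (Vertex G)
    U = filter (λ v → (v ∉? red p) ×-dec (v ∉? blue p)) V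
    first = filter (_∈? N) U
    rest = filter (_∉? N) U
    xs = first ++ take (a ∸ length first) rest

    U! : Unique U
    U! = Uniqueₚ.filter⁺ _ V!

    first≤a : length first ≤ a
    first≤a = ≤-trans (unique-⊆⇒length≤ (Uniqueₚ.filter⁺ (_∈? N) U!) λ v∈ →
      proj₂ (∈-filter⁻ (_∈? N) {xs = U} v∈)) N≤a

    take⊆ : ∀ k {ys : List (Vertex G)} → take k ys ⊆ ys
    take⊆ (suc k) {_ ∷ _} (here eq) = here eq
    take⊆ (suc k) {_ ∷ _} (there v∈) = there (take⊆ k v∈)

    xs! : Unique xs
    xs! = Uniqueₚ.++⁺ (Uniqueₚ.filter⁺ _ U!) (Uniqueₚ.take⁺ _ (Uniqueₚ.filter⁺ _ U!))
      λ (v∈first , v∈rest) → proj₂ (∈-filter⁻ (_∉? N) {xs = U} (take⊆ _ v∈rest))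
        (proj₂ (∈-filter⁻ (_∈? N) {xs = U} v∈first))

    U-free : ∀ {v} → v ∈ U → Unplayed p v
    U-free v∈U = proj₂ (∈-filter⁻ _ {xs = V} v∈U)

    xs-free : ∀ {v} → v ∈ xs → Unplayed p v
    xs-free v∈ = U-free
      ([ proj₁ ∘ ∈-filter⁻ (_∈? N) {xs = U} , proj₁ ∘ ∈-filter⁻ (_∉? N) {xs = U} ∘ take⊆ _ ]′ (∈-++⁻ first v∈))

    ∈U : ∀ {v} → Unplayed p v → v ∈ U
    ∈U free = ∈-filter⁺ _ (∈V _) free

    onto : ∀ {v} → Unplayed p v → v ∈ N → v ∈ xs
    onto free v∈N = ∈-++⁺ˡ (∈-filter⁺ (_∈? N) (∈U free) v∈N)

    length-xs : length xs ≡ length first + (a ∸ length first) ⊓ length rest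
    length-xs = trans (length-++ first) (cong (length first +_) (length-take _ rest))

    amount : length xs ≡ a ⊎ (length xs < a × (∀ v → Unplayed p v → v ∈ xs))
    amount with a ∸ length first ≤? length rest
    ... | yes enough = inj₁
      (trans length-xs (trans (cong (length first +_) (m≤n⇒m⊓n≡m enough)) (m+[n∸m]≡n first≤a)))
    -- Too few vertices for padding: `take` keeps all of `rest`, so the move colours the whole
    -- remaining board.
    ... | no short = inj₂ (xs<a , all)
      where
      rest< : length rest < a ∸ length first
      rest< = ≰⇒> short

      xs<a : length xs < a
      xs<a = subst₂ _<_
        (sym (trans length-xs (cong (length first +_) (m≥n⇒m⊓n≡n (<⇒≤ rest<)))))
        (m+[n∸m]≡n first≤a)
        (+-monoʳ-< (length first) rest<)

      all : ∀ v → Unplayed p v → v ∈ xs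
      all v free with v ∈? N
      ... | yes v∈N = onto free v∈N
      ... | no v∉N = ∈-++⁺ʳ first
        (subst (v ∈_) (sym (take-all _ rest (<⇒≤ rest<))) (∈-filter⁺ (_∉? N) (∈U free) v∉N))

  module _ (v₀ : Vertex G) (neighbour : ∀ v → ∃[ w ] Adj G v w) where

    -- The invariant before each turn of Bob, restored by each reply of Alice.
    Guarded : Position G → Set
    Guarded p = ∀ {u w} → u ∈ blue p → Adj G u w → w ∈ red p

    full-transversal : ∀ {p} → Guarded p → (∀ v → ¬ Unplayed p v) → RedTransversal G p
    full-transversal {p} guarded full K (complete , maximal) with Any.any? (_∈? red p) K
    ... | yes met = find met
    ... | no unmet = ⊥-elim (nonempty K maximal empty)
      where
      nonempty : ∀ K → (∀ L → Complete G L → K ⊆ L → L ⊆ K) → ¬ (∀ {v} → v ∉ K)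
      -- The empty set is complete but not maximal, because the vertex `v₀` extends it.
      nonempty [] max none
        with max (v₀ ∷ []) (λ { (here refl) (here refl) v≢v → contradiction refl v≢v }) (λ ()) (here refl)
      ... | ()
      nonempty (_ ∷ _) _ none = none (here refl)

      ∉red : ∀ {v} → v ∈ K → v ∉ red p
      ∉red v∈K v∈red = unmet (Any.map (λ { refl → v∈red }) v∈K)

      ∈blue : ∀ {v} → v ∈ K → v ∈ blue p
      ∈blue {v} v∈K with v ∈? blue p
      ... | yes v∈blue = v∈blue
      ... | no v∉blue = contradiction (∉red v∈K , v∉blue) (full v)

      -- A clique without red vertices would be a single vertex u, yet u has a neighbour.
      empty : ∀ {u} → u ∉ K
      empty {u} u∈K = ∉red
        (maximal (u ∷ w ∷ []) (edge-complete G _≟_ uw) K⊆ (there (here refl)))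
        (guarded (∈blue u∈K) uw)
        where
        w = proj₁ (neighbour u)
        uw = proj₂ (neighbour u)
        K⊆ : K ⊆ (u ∷ w ∷ [])
        K⊆ {x} x∈K with x ≟ u
        ... | yes refl = here refl
        ... | no x≢u = contradiction (guarded (∈blue u∈K) (complete u∈K x∈K (≢-sym x≢u))) (∉red x∈K)

    -- `k` bounds the number of unplayed vertices and falls with each vertex Bob plays. Alice
    -- reddens the list `N` that `sparse` assigns to his vertex, and `won` is claimed only once
    -- Bob's move is empty, that is, on a full board.
    guarded-wins : ∀ k {p} U → length U ≤ k → (∀ {v} → Unplayed p v → v ∈ U) →
                   Guarded p → Sparse G a (red p) → AliceWins G a 1 bob p
    guarded-wins k {p} U U≤k ∈U guarded sparse = bobMoves reply
      where
      reply : ∀ xs → Move 1 p xs → AliceWins G a 1 alice (colourBlue xs p)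
      reply [] move = won (full-transversal guarded λ v free → full v free (Move.amount move))
        where
        full : ∀ v → Unplayed p v → ¬ (0 ≡ 1 ⊎ (0 < 1 × (∀ w → Unplayed p w → w ∈ [])))
        full v free (inj₂ (_ , all)) with all v free
        ... | ()
      reply (v ∷ []) move = respond k U≤k (delete (∈U v-free)) (sparse v)
        where
        v-free : Unplayed p v
        v-free = All.lookup (Move.unplayed move) (here refl)

        -- `k` is an argument again so that it can be split: `v` lies in `U`, which excludes zero.
        respond : ∀ k → length U ≤ k →
                  ∃[ zs ] (length U ≡ suc (length zs) × (∀ {y} → y ∈ U → y ≢ v → y ∈ zs)) →
                  v ∈ red p ⊎ ∃[ N ] (length N ≤ a × (∀ {w} → Adj G v w → w ∈ red p ⊎ w ∈ N)) →
                  AliceWins G a 1 alice (colourBlue (v ∷ []) p)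
        respond zero U≤0 (_ , eq , _) _ = contradiction (subst (_≤ 0) eq U≤0) λ ()
        respond (suc k) _ _ (inj₁ v∈red) = contradiction v∈red (proj₁ v-free)
        respond (suc k) U≤ (zs , eq , keep) (inj₂ (N , N≤a , ∈N)) with moveOnto (colourBlue (v ∷ []) p) N N≤a
        ... | ys , ys-move , onto = aliceMoves ys ys-move
          (guarded-wins k {position (ys ++ red p) (v ∷ blue p)} zs
            (s≤s⁻¹ (subst (_≤ suc k) eq U≤)) ∈zs guarded′ sparse′)
          where
          ∈zs : ∀ {w} → Unplayed {G} (position (ys ++ red p) (v ∷ blue p)) w → w ∈ zs
          ∈zs (w∉red , w∉blue) = keep (∈U (w∉red ∘ ∈-++⁺ʳ ys , w∉blue ∘ there)) (w∉blue ∘ here)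

          guarded′ : Guarded (position (ys ++ red p) (v ∷ blue p))
          guarded′ (there u∈) uw = ∈-++⁺ʳ ys (guarded u∈ uw)
          guarded′ {w = w} (here refl) vw with w ∈? red p | ∈N vw
          ... | yes w∈red | _ = ∈-++⁺ʳ ys w∈red
          ... | no w∉red | inj₁ w∈red = contradiction w∈red w∉red
          ... | no w∉red | inj₂ w∈N = ∈-++⁺ˡ (onto (w∉red , w∉blue) w∈N)
            where
            w∉blue : w ∉ v ∷ blue p
            w∉blue (here refl) = Adj-irrefl G vw
            -- Were `w` blue before, `Guarded` would have made `v` red, but `v` was unplayed.
            w∉blue (there w∈) = proj₁ v-free (guarded w∈ (Adj-sym G vw))

          sparse′ : Sparse G a (ys ++ red p)
          -- The same list `M` still serves: its bound and the covering of neighbours survive when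
          -- more vertices turn red.
          sparse′ u = Sum.map (∈-++⁺ʳ ys)
            (λ (M , M≤a , ∈M) → M , M≤a , λ uw → Sum.map₁ (∈-++⁺ʳ ys) (∈M uw)) (sparse u)
      reply (_ ∷ _ ∷ _) move = contradiction (Move.amount move) λ { (inj₁ ()) ; (inj₂ (s≤s () , _)) }

    sparse-bob : Sparse G a [] → AliceWins G a 1 bob start
    sparse-bob = guarded-wins (length V) V ≤-refl (λ _ → ∈V _) λ ()

    -- `S` is the opening move, filled up to size. Without blue vertices `Guarded` is vacuous, and
    -- additional red vertices do not harm sparseness.
    sparse-alice : ∀ {S} → length S ≤ a → Sparse G a S → AliceWins G a 1 alice start
    sparse-alice {S} S≤a sparse with moveOnto start S S≤a
    ... | xs , move , onto = aliceMoves xs move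
      (guarded-wins (length V) V ≤-refl (λ _ → ∈V _) (λ ())
        λ v → Sum.map S⊆ (λ (M , M≤a , ∈M) → M , M≤a , λ vw → Sum.map₁ S⊆ (∈M vw)) (sparse v))
      where
      S⊆ : S ⊆ xs ++ []
      S⊆ v∈S = ∈-++⁺ˡ (onto ((λ ()) , λ ()) v∈S)

-- Coordinates and decidable checks

Coord : Set
Coord = ℕ × ℕ

_≟ᶜ_ : DecidableEquality Coord
_≟ᶜ_ = ≡-dec _≟_ _≟_

open DecMembership _≟ᶜ_ using (_∈?_; _∉?_)

box : ℕ → ℕ → List Coord
box n m = cartesianProduct (upTo n) (upTo m)

below : ℕ → List ℕ
below zero = []
below (suc i) = i ∷ []

line : ℕ → ℕ → List ℕ
line n i = filter (_<? n) (suc i ∷ below i)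

-- With natural numbers instead of `Fin`, grids of all sizes share their coordinates, so deletions
-- and stars pass between a grid and its subgrids without renaming.
nbrs : ℕ → ℕ → Coord → List Coord
nbrs n m (i , j) = map (_, j) (line n i) ++ map (i ,_) (line m j)

line-unique : ∀ n i → Unique (line n i)
line-unique n zero = Uniqueₚ.filter⁺ (_<? n) ([] ∷ [])
line-unique n (suc i) = Uniqueₚ.filter⁺ (_<? n) (((λ ()) ∷ []) ∷ [] ∷ [])

∈-line⁻ : ∀ {n} i {x} → x ∈ line n i → x < n × (suc i ≡ x ⊎ suc x ≡ i)
∈-line⁻ {n} i x∈ with ∈-filter⁻ (_<? n) {xs = suc i ∷ below i} x∈
... | here refl , x<n = x<n , inj₁ refl
∈-line⁻ (suc i) x∈ | there (here refl) , x<n = x<n , inj₂ refl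

∈-line⁺ : ∀ {n i x} → x < n → suc i ≡ x ⊎ suc x ≡ i → x ∈ line n i
∈-line⁺ {n} x<n (inj₁ refl) = ∈-filter⁺ (_<? n) (here refl) x<n
∈-line⁺ {n} x<n (inj₂ refl) = ∈-filter⁺ (_<? n) (there (here refl)) x<n

nbrs-unique : ∀ n m v → Unique (nbrs n m v)
nbrs-unique n m (i , j) = Uniqueₚ.++⁺
  (Uniqueₚ.map⁺ (cong proj₁) (line-unique n i)) (Uniqueₚ.map⁺ (cong proj₂) (line-unique m j)) disjoint
  where
  disjoint : ∀ {v} → ¬ (v ∈ map (_, j) (line n i) × v ∈ map (i ,_) (line m j))
  disjoint (v∈₁ , v∈₂) with ∈-map⁻ (_, j) v∈₁ | ∈-map⁻ (i ,_) v∈₂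
  ... | _ , i∈ , refl | _ , _ , refl with ∈-line⁻ {n} i i∈
  ... | _ , inj₁ eq = 1+n≢n eq
  ... | _ , inj₂ eq = 1+n≢n eq

length-line : ∀ n i → length (line n i) ≤ 2
length-line n i = ≤-trans (length-filter (_<? n) (suc i ∷ below i)) (s≤s (length-below i))
  where
  length-below : ∀ i → length (below i) ≤ 1
  length-below zero = z≤n
  length-below (suc i) = ≤-refl

length-nbrs : ∀ n m i j → length (nbrs n m (i , j)) ≡ length (line n i) + length (line m j)
length-nbrs n m i j = trans (length-++ (map (_, j) (line n i)))
  (cong₂ _+_ (length-map (_, j) (line n i)) (length-map (i ,_) (line m j)))

length-nbrs≤4 : ∀ n m v → length (nbrs n m v) ≤ 4
length-nbrs≤4 n m (i , j) = subst (_≤ 4) (sym (length-nbrs n m i j)) (+-mono-≤ (length-line n i) (length-line m j))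

length-nbrs≤3 : ∀ m {i} j → i < 2 → length (nbrs 2 m (i , j)) ≤ 3
length-nbrs≤3 m {i} j i<2 = subst (_≤ 3) (sym (length-nbrs 2 m i j)) (+-mono-≤ (single i i<2) (length-line m j))
  where
  single : ∀ i → i < 2 → length (line 2 i) ≤ 1
  single 0 _ = ≤-refl
  single 1 _ = ≤-refl
  single (suc (suc _)) (s≤s (s≤s ()))

-- `Sparse` in coordinates, in a form decided by evaluation.
Scattered : ℕ → ℕ → ℕ → List Coord → Set
Scattered n m a S = All (λ v → v ∈ S ⊎ length (filter (_∉? S) (nbrs n m v)) ≤ a) (box n m)

scattered? : ∀ n m a S → Dec (Scattered n m a S)
scattered? n m a S = All.all? (λ v → (v ∈? S) ⊎-dec (length (filter (_∉? S) (nbrs n m v)) ≤? a)) (box n m)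

Overloaded : ℕ → ℕ → ℕ → List Coord → Coord → Set
Overloaded n m a S v = v ∉ S × a < length (filter (_∉? S) (nbrs n m v))

-- However k further vertices are added to S, an overloaded vertex remains.  To
-- unload v, one of v and its neighbours has to be added, so it suffices to
-- branch over these.
Overloads : ℕ → ℕ → ℕ → ℕ → List Coord → Set
Overloads n m a zero S = Any (Overloaded n m a S) (box n m)
Overloads n m a (suc k) S =
  Any (λ v → Overloaded n m a S v × All (λ x → Overloads n m a k (x ∷ S)) (v ∷ nbrs n m v)) (box n m)

overloads? : ∀ n m a k S → Dec (Overloads n m a k S)
overloads? n m a zero S = Any.any? (λ v → (v ∉? S) ×-dec (a <? length (filter (_∉? S) (nbrs n m v)))) (box n m)
overloads? n m a (suc k) S =
  Any.any? (λ v → ((v ∉? S) ×-dec (a <? length (filter (_∉? S) (nbrs n m v))))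
                  ×-dec All.all? (λ x → overloads? n m a k (x ∷ S)) (v ∷ nbrs n m v)) (box n m)

-- What Bob needs in `overload-lost`, when `Z` holds the coordinates of the red vertices.
Star : ℕ → ℕ → ℕ → List Coord → Set
Star n m a Z = ∃[ v ] ∃[ T ] (v ∈ box n m × v ∉ Z × Unique T × a < length T ×
  (∀ {t} → t ∈ T → t ∈ nbrs n m v × t ∉ Z))

-- `S` holds the vertices added along the current branch, and `R` covers the part of `Z` outside
-- `S`. If `R` misses the overloaded vertex and its neighbours, they give the star; otherwise a
-- common vertex moves from `R` to `S` along its branch, using up one unit of `k`.
overloads-star : ∀ n m a {Z} k S R → length R ≤ k → (∀ {z} → z ∈ Z → z ∈ S ⊎ z ∈ R) →
                 Overloads n m a k S → Star n m a Z
overloads-star n m a {Z} k S R R≤k Z⊆ overloads = go k R≤k overloads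
  where
  star : ∀ {v} → v ∈ box n m → Overloaded n m a S v → (∀ {x} → x ∈ v ∷ nbrs n m v → x ∉ R) → Star n m a Z
  star {v} v∈ (v∉S , a<) missed =
    v , filter (_∉? S) (nbrs n m v) , v∈ , (λ v∈Z → [ v∉S , missed (here refl) ]′ (Z⊆ v∈Z)) ,
    Uniqueₚ.filter⁺ (_∉? S) (nbrs-unique n m v) , a< , λ t∈ →
      let t∈nbrs , t∉S = ∈-filter⁻ (_∉? S) {xs = nbrs n m v} t∈
      in t∈nbrs , λ t∈Z → [ t∉S , missed (there t∈nbrs) ]′ (Z⊆ t∈Z)

  go : ∀ k → length R ≤ k → Overloads n m a k S → Star n m a Z
  go zero R≤0 any with find any
  ... | v , v∈ , overloaded = star v∈ overloaded λ _ x∈R → contradiction (≤-trans (∈-length x∈R) R≤0) λ ()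
  go (suc k) R≤ any with find any
  ... | v , v∈ , overloaded , branches with Any.any? (_∈? R) (v ∷ nbrs n m v)
  ...   | no none = star v∈ overloaded λ x∈ x∈R → none (Any.map (λ { refl → x∈R }) x∈)
  ...   | yes hit with find hit
  ...     | x , x∈ , x∈R with delete x∈R
  ...       | R′ , eq , keep = overloads-star n m a k (x ∷ S) R′
              (s≤s⁻¹ (subst (_≤ suc k) eq R≤)) Z⊆′ (All.lookup branches x∈)
    where
    Z⊆′ : ∀ {z} → z ∈ Z → z ∈ x ∷ S ⊎ z ∈ R′
    Z⊆′ {z} z∈Z with z ≟ᶜ x
    ... | yes refl = inj₁ (here refl)
    ... | no z≢x = Sum.map there (λ z∈R → keep z∈R z≢x) (Z⊆ z∈Z)

-- Grid graphs and their subgrids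

parity-suc : ∀ {m n} → suc m ≡ n → parity n ≡ parity m ⁻¹
parity-suc {m} refl = trans (sym (⁻¹-involutive (parity (suc m)))) (cong _⁻¹ (suc-homo-⁻¹ m))

module _ (n m : ℕ) where

  grid : Graph
  grid = P n □ P m

  _≟ᵛ_ : DecidableEquality (Vertex grid)
  _≟ᵛ_ = ≡-dec Fin._≟_ Fin._≟_

  coord : Vertex grid → Coord
  coord (i , j) = toℕ i , toℕ j

  coord-injective : ∀ {u v} → coord u ≡ coord v → u ≡ v
  coord-injective eq = cong₂ _,_ (toℕ-injective (cong proj₁ eq)) (toℕ-injective (cong proj₂ eq))

  vertex : ∀ {i j} → i < n → j < m → ∃[ v ] coord v ≡ (i , j)
  vertex i<n j<m = (fromℕ< i<n , fromℕ< j<m) , cong₂ _,_ (toℕ-fromℕ< i<n) (toℕ-fromℕ< j<m)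

  vertices : List (Vertex grid)
  vertices = cartesianProduct (allFin n) (allFin m)

  vertices! : Unique vertices
  vertices! = Uniqueₚ.cartesianProduct⁺ (Uniqueₚ.allFin⁺ n) (Uniqueₚ.allFin⁺ m)

  ∈-vertices : ∀ v → v ∈ vertices
  ∈-vertices (i , j) = ∈-cartesianProduct⁺ (∈-allFin i) (∈-allFin j)

  -- The checkerboard colouring. Adjacent vertices have opposite colours, so a triangle would need a
  -- third colour.
  colour : Vertex grid → Parity
  colour (i , j) = parity (toℕ i + toℕ j)

  adj⇒colour : ∀ {u v} → Adj grid u v → colour u ≡ colour v ⁻¹
  adj⇒colour {u} {v} uv = [ flip ∘ parity-suc , parity-suc ]′ (sums uv)
    where
    flip : ∀ {p q} → p ≡ q ⁻¹ → q ≡ p ⁻¹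
    flip {q = q} eq = trans (sym (⁻¹-involutive q)) (cong _⁻¹ (sym eq))

    sum : Vertex grid → ℕ
    sum (i , j) = toℕ i + toℕ j

    sums : Adj grid u v → suc (sum u) ≡ sum v ⊎ suc (sum v) ≡ sum u
    sums (inj₁ (inj₁ eq , refl)) = inj₁ (cong (_+ _) eq)
    sums (inj₁ (inj₂ eq , refl)) = inj₂ (cong (_+ _) eq)
    sums (inj₂ (refl , inj₁ eq)) = inj₁ (trans (sym (+-suc _ _)) (cong (_ +_) eq))
    sums (inj₂ (refl , inj₂ eq)) = inj₂ (trans (sym (+-suc _ _)) (cong (_ +_) eq))

  grid-triangleFree : TriangleFree grid
  grid-triangleFree {u} {v} {w} uv vw uw = p≢p⁻¹ (colour v)
    (trans (adj⇒colour {v} {w} vw) (trans (sym (adj⇒colour {u} {w} uw)) (adj⇒colour {u} {v} uv)))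

  -- The bounds go opposite ways here and in `nbrs⇒adj`: a deletion set is checked on a grid that
  -- contains this one, an overload on a subgrid of this one.
  adj⇒nbrs : ∀ {n′ m′} → n ≤ n′ → m ≤ m′ → ∀ {v w} → Adj grid v w → coord w ∈ nbrs n′ m′ (coord v)
  adj⇒nbrs n≤ m≤ {w = i , j} (inj₁ (e , refl)) = ∈-++⁺ˡ (∈-map⁺ _ (∈-line⁺ (≤-trans (toℕ<n i) n≤) e))
  adj⇒nbrs {n′} n≤ m≤ {v = v} {w = i , j} (inj₂ (refl , e)) =
    ∈-++⁺ʳ (map (_, toℕ (proj₂ v)) (line n′ (toℕ i))) (∈-map⁺ _ (∈-line⁺ (≤-trans (toℕ<n j) m≤) e))

  nbrs⇒adj : ∀ {n′ m′} → n′ ≤ n → m′ ≤ m → ∀ {v t} → t ∈ nbrs n′ m′ (coord v) →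
             ∃[ w ] (coord w ≡ t × Adj grid v w)
  nbrs⇒adj {n′} {m′} n′≤ m′≤ {v = i , j} {t} t∈ with ∈-++⁻ (map (_, toℕ j) (line n′ (toℕ i))) t∈
  ... | inj₁ t∈₁ with ∈-map⁻ (_, toℕ j) t∈₁
  ...   | x , x∈ , refl with ∈-line⁻ (toℕ i) x∈
  ...     | x<n′ , e = (fromℕ< x<n , j) , cong (_, toℕ j) (toℕ-fromℕ< x<n) ,
              inj₁ (subst (λ y → suc (toℕ i) ≡ y ⊎ suc y ≡ toℕ i) (sym (toℕ-fromℕ< x<n)) e , refl)
    where x<n = ≤-trans x<n′ n′≤
  nbrs⇒adj {n′} {m′} n′≤ m′≤ {v = i , j} {t} t∈ | inj₂ t∈₂ with ∈-map⁻ (toℕ i ,_) t∈₂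
  ...   | x , x∈ , refl with ∈-line⁻ (toℕ j) x∈
  ...     | x<m′ , e = (i , fromℕ< x<m) , cong (toℕ i ,_) (toℕ-fromℕ< x<m) ,
              inj₂ (refl , subst (λ y → suc (toℕ j) ≡ y ⊎ suc y ≡ toℕ j) (sym (toℕ-fromℕ< x<m)) e)
    where x<m = ≤-trans x<m′ m′≤

  -- Coordinates beyond this grid are dropped, so a deletion set for a larger grid restricts to it
  -- and does not grow.
  at : List Coord → List (Vertex grid)
  at S = filter (λ v → coord v ∈? S) vertices

  ∈-at⁺ : ∀ {S v} → coord v ∈ S → v ∈ at S
  ∈-at⁺ {S} = ∈-filter⁺ (λ v → coord v ∈? S) (∈-vertices _)

  length-at : ∀ S → length (at S) ≤ length S
  length-at S = subst (_≤ length S) (length-map coord (at S))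
    (unique-⊆⇒length≤ (Uniqueₚ.map⁺ coord-injective (Uniqueₚ.filter⁺ _ vertices!)) ⊆S)
    where
    ⊆S : map coord (at S) ⊆ S
    ⊆S x∈ with ∈-map⁻ coord x∈
    ... | v , v∈ , refl = proj₂ (∈-filter⁻ (λ v → coord v ∈? S) {xs = vertices} v∈)

  -- Shrinking the grid only takes neighbours away.
  scattered⇒sparse : ∀ {n′ m′ a S} → n ≤ n′ → m ≤ m′ → Scattered n′ m′ a S → Sparse grid a (at S)
  scattered⇒sparse {n′} {m′} {a} {S} n≤ m≤ scattered v@(i , j) = Sum.map ∈-at⁺
    (λ few → at (remaining v) , ≤-trans (length-at (remaining v)) few , split)
    (All.lookup scattered (∈-cartesianProduct⁺ (∈-upTo⁺ (≤-trans (toℕ<n i) n≤)) (∈-upTo⁺ (≤-trans (toℕ<n j) m≤))))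
    where
    remaining : Vertex grid → List Coord
    remaining v = filter (_∉? S) (nbrs n′ m′ (coord v))

    split : ∀ {w} → Adj grid v w → w ∈ at S ⊎ w ∈ at (remaining v)
    split {w} vw with coord w ∈? S
    ... | yes w∈S = inj₁ (∈-at⁺ w∈S)
    ... | no w∉S = inj₂ (∈-at⁺ (∈-filter⁺ (_∉? S) (adj⇒nbrs n≤ m≤ {v} {w} vw) w∉S))

  module _ (2≤n : 2 ≤ n) (1≤m : 1 ≤ m) where

    corner : Vertex grid
    corner = fromℕ< (<⇒≤ 2≤n) , fromℕ< 1≤m

    neighbour : ∀ v → ∃[ w ] Adj grid v w
    neighbour (i , j) with toℕ i in eq
    ... | zero = (fromℕ< 2≤n , j) , inj₁ (inj₁ (trans (cong suc eq) (sym (toℕ-fromℕ< 2≤n))) , refl)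
    ... | suc k = (fromℕ< k<n , j) , inj₁ (inj₂ (trans (cong suc (toℕ-fromℕ< k<n)) (sym eq)) , refl)
      where
      k<n : k < n
      k<n = <⇒≤ (subst (_< n) eq (toℕ<n i))

    scattered-alice : ∀ {n′ m′ a} S → n ≤ n′ → m ≤ m′ → length S ≤ a → Scattered n′ m′ a S →
                      AliceWins grid a 1 alice start
    scattered-alice S n≤ m≤ S≤a scattered =
      sparse-alice grid _≟ᵛ_ vertices! ∈-vertices corner neighbour
        (≤-trans (length-at S) S≤a) (scattered⇒sparse n≤ m≤ scattered)

    scattered-bob : ∀ {n′ m′ a} → n ≤ n′ → m ≤ m′ → Scattered n′ m′ a [] → AliceWins grid a 1 bob start
    scattered-bob n≤ m≤ scattered =
      sparse-bob grid _≟ᵛ_ vertices! ∈-vertices corner neighbour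
        (subst (Sparse grid _) (empty (length-at [])) (scattered⇒sparse n≤ m≤ scattered))
      where
      empty : ∀ {xs : List (Vertex grid)} → length xs ≤ 0 → xs ≡ []
      empty {[]} _ = refl

  -- A larger grid keeps every neighbour and a smaller `a` gives Alice less, so a star with bound
  -- `b` in a subgrid is still an overload here.
  star-lost : ∀ {n′ m′ a b} → n′ ≤ n → m′ ≤ m → a ≤ b → ∀ {R} →
              Star n′ m′ b (map coord R) → ¬ AliceWins grid a 1 bob (position R [])
  star-lost {n′} {m′} {a} {b} n′≤ m′≤ a≤b {R} ((i , j) , T , ij∈ , ij∉ , T! , b<T , T-free)
    with ∈-cartesianProduct⁻ (upTo n′) (upTo m′) ij∈
  ... | i∈ , j∈ with vertex (≤-trans (∈-upTo⁻ i∈) n′≤) (≤-trans (∈-upTo⁻ j∈) m′≤)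
  ...   | v , refl = overload-lost grid _≟ᵛ_ grid-triangleFree
    (ij∉ ∘ ∈-map⁺ coord , λ ()) (Uniqueₚ.filter⁺ _ vertices!) (≤-<-trans a≤b (<-≤-trans b<T T≤)) free
    where
    -- `at` loses nothing of `T`: each element is a neighbour of `v` within the subgrid, hence a
    -- vertex here.
    T⊆ : T ⊆ map coord (at T)
    T⊆ t∈ with nbrs⇒adj n′≤ m′≤ {v} (proj₁ (T-free t∈))
    ... | w , refl , _ = ∈-map⁺ coord (∈-at⁺ t∈)

    T≤ : length T ≤ length (at T)
    T≤ = subst (length T ≤_) (length-map coord (at T)) (unique-⊆⇒length≤ T! T⊆)

    free : ∀ {t} → t ∈ at T → Adj grid v t × Unplayed {grid} (position R []) t
    free {t} t∈ with proj₂ (∈-filter⁻ (λ v → coord v ∈? T) {xs = vertices} t∈)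
    ... | t∈T with nbrs⇒adj n′≤ m′≤ {v} (proj₁ (T-free t∈T))
    ...   | w , eq , vw = subst (Adj grid v) (coord-injective eq) vw ,
              (λ t∈R → proj₂ (T-free t∈T) (∈-map⁺ coord t∈R)) , λ ()

  overloads-bob : ∀ {n′ m′ a b} → n′ ≤ n → m′ ≤ m → a ≤ b → Overloads n′ m′ b 0 [] →
                  ¬ AliceWins grid a 1 bob start
  overloads-bob {n′} {m′} {b = b} n′≤ m′≤ a≤b overloads =
    star-lost n′≤ m′≤ a≤b (overloads-star n′ m′ b 0 [] [] z≤n (λ ()) overloads)

  -- The bound `b` occurs twice: the first turn reddens at most `b` vertices, and a vertex is
  -- overloaded by more than `b` remaining neighbours. The check at `b` also disposes of all smaller
  -- `a`.
  overloads-alice : ∀ {n′ m′ a b} → n′ ≤ n → m′ ≤ m → a ≤ b → Overloads n′ m′ b b [] →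
                    ¬ AliceWins grid a 1 alice start
  overloads-alice {n′} {m′} {a} {b} n′≤ m′≤ a≤b overloads = lost
    where
    star : ∀ xs → length xs ≤ b → Star n′ m′ b (map coord xs)
    star xs xs≤b =
      overloads-star n′ m′ b b [] (map coord xs) (subst (_≤ b) (sym (length-map coord xs)) xs≤b) inj₂ overloads

    lost : ¬ AliceWins grid a 1 alice start
    -- `won` does not depend on the player to move, so the star of the empty board refutes it.
    lost (won meets) = star-lost n′≤ m′≤ a≤b (star [] z≤n) (won meets)
    lost (aliceMoves xs move wins) =
      star-lost n′≤ m′≤ a≤b (star (xs ++ [])
        (subst (_≤ b) (sym (cong length (++-identityʳ xs))) (≤-trans xs≤a a≤b))) wins
      where
      xs≤a : length xs ≤ a
      xs≤a = [ ≤-reflexive , <⇒≤ ∘ proj₁ ]′ (Move.amount move)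

-- Finite checks on the extremal grids

smallest : ∀ {Q : ℕ → Set} {k} → Q (suc k) → (∀ {j} → j ≤ k → ¬ Q j) → SmallestPositive Q (suc k)
smallest {k = k} q minimal = s≤s z≤n , q , above
  where
  above : ∀ j → 1 ≤ j → _ → suc k ≤ j
  above j _ qj with suc k ≤? j
  ... | yes k<j = k<j
  ... | no k≮j = contradiction qj (minimal (s≤s⁻¹ (≰⇒> k≮j)))

scattered-4 : ∀ n m → Scattered n m 4 []
scattered-4 n m = All.tabulate λ {v} _ → inj₂ (≤-trans (length-filter (_∉? []) (nbrs n m v)) (length-nbrs≤4 n m v))

scattered-3 : ∀ m → Scattered 2 m 3 []
scattered-3 m = All.tabulate λ { {i , j} v∈ → inj₂ (≤-trans (length-filter (_∉? []) (nbrs 2 m (i , j)))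
  (length-nbrs≤3 m j (∈-upTo⁻ (proj₁ (∈-cartesianProduct⁻ (upTo 2) (upTo m) v∈))))) }

scattered-2×2 : Scattered 2 2 2 []
scattered-2×2 = toWitness {a? = scattered? 2 2 2 []} tt

-- For `a = 2`, removing the middle column of 2 × 5 leaves two 4-cycles, and removing the two inner
-- vertices of 3 × 4 leaves the boundary cycle. For `a = 3` only vertices of degree 4 matter, and
-- the hubs dominate them: they form a path on nine vertices, a 2 × 5 grid and a 3 × 3 grid.
hub-2×5 hub-3×4 hub-3×11 hub-4×7 hub-5×5 : List Coord
hub-2×5  = (0 , 2) ∷ (1 , 2) ∷ []
hub-3×4  = (1 , 1) ∷ (1 , 2) ∷ []
hub-3×11 = (1 , 2) ∷ (1 , 5) ∷ (1 , 8) ∷ []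
hub-4×7  = (1 , 1) ∷ (2 , 3) ∷ (1 , 5) ∷ []
hub-5×5  = (1 , 1) ∷ (1 , 3) ∷ (3 , 2) ∷ []

scattered-2×5 : Scattered 2 5 2 hub-2×5
scattered-2×5 = toWitness {a? = scattered? 2 5 2 hub-2×5} tt

scattered-3×4 : Scattered 3 4 2 hub-3×4
scattered-3×4 = toWitness {a? = scattered? 3 4 2 hub-3×4} tt

scattered-3×11 : Scattered 3 11 3 hub-3×11
scattered-3×11 = toWitness {a? = scattered? 3 11 3 hub-3×11} tt

scattered-4×7 : Scattered 4 7 3 hub-4×7
scattered-4×7 = toWitness {a? = scattered? 4 7 3 hub-4×7} tt

scattered-5×5 : Scattered 5 5 3 hub-5×5
scattered-5×5 = toWitness {a? = scattered? 5 5 3 hub-5×5} tt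

overloads-2×2 : Overloads 2 2 1 1 []
overloads-2×2 = toWitness {a? = overloads? 2 2 1 1 []} tt

overloads-2×6 : Overloads 2 6 2 2 []
overloads-2×6 = toWitness {a? = overloads? 2 6 2 2 []} tt

overloads-3×5 : Overloads 3 5 2 2 []
overloads-3×5 = toWitness {a? = overloads? 3 5 2 2 []} tt

overloads-4×4 : Overloads 4 4 2 2 []
overloads-4×4 = toWitness {a? = overloads? 4 4 2 2 []} tt

-- Here an overloaded vertex has degree 4 and is neither deleted nor next to a deletion. In this and
-- the next two checks the vertices of degree 4 form a path on ten vertices, a 2 × 6 grid and a 3 ×
-- 4 grid, none of which three vertices can dominate.
overloads-3×12 : Overloads 3 12 3 3 []
overloads-3×12 = toWitness {a? = overloads? 3 12 3 3 []} tt

overloads-4×8 : Overloads 4 8 3 3 []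
overloads-4×8 = toWitness {a? = overloads? 4 8 3 3 []} tt

overloads-5×6 : Overloads 5 6 3 3 []
overloads-5×6 = toWitness {a? = overloads? 5 6 3 3 []} tt

-- Without deletions an overload is a vertex of degree above the bound: any vertex of 2 × 2, a
-- middle one of 2 × 3, the centre of 3 × 3.
overloads-bob-2×2 : Overloads 2 2 1 0 []
overloads-bob-2×2 = toWitness {a? = overloads? 2 2 1 0 []} tt

overloads-bob-2×3 : Overloads 2 3 2 0 []
overloads-bob-2×3 = toWitness {a? = overloads? 2 3 2 0 []} tt

overloads-bob-3×3 : Overloads 3 3 3 0 []
overloads-bob-3×3 = toWitness {a? = overloads? 3 3 3 0 []} tt

-- Case distinction and thresholds

Two Three : ℕ → ℕ → Set
Two n m = (n ≡ 2 × 2 ≤ m × m ≤ 5) ⊎ (n ≡ 3 × (m ≡ 3 ⊎ m ≡ 4))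
Three n m = (n ≡ 2 × 6 ≤ m) ⊎ (n ≡ 3 × 5 ≤ m × m ≤ 11) ⊎ (n ≡ 4 × 4 ≤ m × m ≤ 7) ⊎ (n ≡ 5 × m ≡ 5)

-- The targets are the three minimal grids on which Alice loses with `a = 3`: `n = 3` leads to the
-- first, `n = 4` to the second and `n ≥ 5` to the third, while `n = 2` is always covered by the
-- excluded cases.
large : ∀ n m → 2 ≤ n → n ≤ m → ¬ Two n m → ¬ Three n m →
        (3 ≤ n × 12 ≤ m) ⊎ (4 ≤ n × 8 ≤ m) ⊎ (5 ≤ n × 6 ≤ m)
large 1 m (s≤s ()) _ _ _
large 2 m 2≤n n≤m ¬two ¬three with m ≤? 5
... | yes m≤5 = contradiction (inj₁ (refl , n≤m , m≤5)) ¬two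
... | no m≰5 = contradiction (inj₁ (refl , ≰⇒> m≰5)) ¬three
large 3 m 2≤n n≤m ¬two ¬three with m ≤? 11 | m ≤? 4 | m≤n⇒m<n∨m≡n n≤m
... | no m≰11 | _ | _ = inj₁ (≤-refl , ≰⇒> m≰11)
... | yes m≤11 | no m≰4 | _ = contradiction (inj₂ (inj₁ (refl , ≰⇒> m≰4 , m≤11))) ¬three
... | yes _ | yes m≤4 | inj₁ 4≤m = contradiction (inj₂ (refl , inj₂ (≤-antisym m≤4 4≤m))) ¬two
... | yes _ | yes _ | inj₂ 3≡m = contradiction (inj₂ (refl , inj₁ (sym 3≡m))) ¬two
large 4 m 2≤n n≤m ¬two ¬three with m ≤? 7
... | yes m≤7 = contradiction (inj₂ (inj₂ (inj₁ (refl , n≤m , m≤7)))) ¬three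
... | no m≰7 = inj₂ (inj₁ (≤-refl , ≰⇒> m≰7))
large 5 m 2≤n n≤m ¬two ¬three with m≤n⇒m<n∨m≡n n≤m
... | inj₁ 6≤m = inj₂ (inj₂ (≤-refl , 6≤m))
... | inj₂ 5≡m = contradiction (inj₂ (inj₂ (inj₂ (refl , sym 5≡m)))) ¬three
large (suc (suc (suc (suc (suc (suc n)))))) m _ n≤m _ _ = inj₂ (inj₂ (m≤m+n 5 (suc n) , ≤-trans (m≤m+n 6 n) n≤m))

theorem4p9 : ∀ (n m : ℕ) → 2 ≤ n → n ≤ m →
  let two   = (n ≡ 2 × 2 ≤ m × m ≤ 5) ⊎ (n ≡ 3 × (m ≡ 3 ⊎ m ≡ 4))
      three = (n ≡ 2 × 6 ≤ m) ⊎ (n ≡ 3 × 5 ≤ m × m ≤ 11) ⊎ (n ≡ 4 × 4 ≤ m × m ≤ 7) ⊎ (n ≡ 5 × m ≡ 5)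
  in
  ((two → a₁ (P n □ P m) 2) ×
   (three → a₁ (P n □ P m) 3) ×
   (¬ two → ¬ three → a₁ (P n □ P m) 4)) ×
  ((n ≡ 2 × m ≡ 2 → a₁′ (P n □ P m) 2) ×
   (n ≡ 2 × 3 ≤ m → a₁′ (P n □ P m) 3) ×
   (3 ≤ n → a₁′ (P n □ P m) 4))
theorem4p9 n m 2≤n n≤m = (a₁-two , a₁-three , a₁-four) , (a₁′-two , a₁′-three , a₁′-four)
  where
  G : Graph
  G = P n □ P m

  1≤m : 1 ≤ m
  1≤m = ≤-trans (<⇒≤ 2≤n) n≤m

  aliceWins : ∀ {n′ m′ a} S → n ≤ n′ → m ≤ m′ → length S ≤ a → Scattered n′ m′ a S →
              AliceWins G a 1 alice start
  aliceWins = scattered-alice n m 2≤n 1≤m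

  bobStart : ∀ {n′ m′ a} → n ≤ n′ → m ≤ m′ → Scattered n′ m′ a [] → AliceWins G a 1 bob start
  bobStart = scattered-bob n m 2≤n 1≤m

  a₁-two : Two n m → a₁ G 2
  a₁-two two = smallest (wins two) λ j≤1 → overloads-alice n m 2≤n (≤-trans 2≤n n≤m) j≤1 overloads-2×2
    where
    wins : Two n m → AliceWins G 2 1 alice start
    -- For `m = 2` the hub column lies outside the grid, and the opening move is padding only.
    wins (inj₁ (n≡2 , _ , m≤5)) = aliceWins hub-2×5 (≤-reflexive n≡2) m≤5 ≤-refl scattered-2×5
    wins (inj₂ (n≡3 , m≡)) =
      aliceWins hub-3×4 (≤-reflexive n≡3) ([ (λ { refl → n≤1+n 3 }) , ≤-reflexive ]′ m≡) ≤-refl scattered-3×4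

  a₁-three : Three n m → a₁ G 3
  a₁-three (inj₁ (n≡2 , 6≤m)) = smallest
    -- A ladder has maximum degree at most 3, so any opening move will do.
    (aliceWins [] (≤-reflexive n≡2) ≤-refl z≤n (scattered-3 m))
    λ j≤2 → overloads-alice n m 2≤n 6≤m j≤2 overloads-2×6
  a₁-three (inj₂ (inj₁ (n≡3 , 5≤m , m≤11))) = smallest
    (aliceWins hub-3×11 (≤-reflexive n≡3) m≤11 ≤-refl scattered-3×11)
    λ j≤2 → overloads-alice n m (≤-reflexive (sym n≡3)) 5≤m j≤2 overloads-3×5
  a₁-three (inj₂ (inj₂ (inj₁ (n≡4 , 4≤m , m≤7)))) = smallest
    (aliceWins hub-4×7 (≤-reflexive n≡4) m≤7 ≤-refl scattered-4×7)
    λ j≤2 → overloads-alice n m (≤-reflexive (sym n≡4)) 4≤m j≤2 overloads-4×4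
  a₁-three (inj₂ (inj₂ (inj₂ (n≡5 , m≡5)))) = smallest
    (aliceWins hub-5×5 (≤-reflexive n≡5) (≤-reflexive m≡5) ≤-refl scattered-5×5)
    λ j≤2 → overloads-alice n m (4≤ n≡5) (4≤ m≡5) j≤2 overloads-4×4
    where
    4≤ : ∀ {k} → k ≡ 5 → 4 ≤ k
    4≤ refl = n≤1+n 4

  a₁-four : ¬ Two n m → ¬ Three n m → a₁ G 4
  a₁-four ¬two ¬three = smallest (aliceWins [] ≤-refl ≤-refl z≤n (scattered-4 n m))
    (loses (large n m 2≤n n≤m ¬two ¬three))
    where
    loses : (3 ≤ n × 12 ≤ m) ⊎ (4 ≤ n × 8 ≤ m) ⊎ (5 ≤ n × 6 ≤ m) → ∀ {j} → j ≤ 3 → ¬ AliceWins G j 1 alice start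
    loses (inj₁ (3≤n , 12≤m)) j≤3 = overloads-alice n m 3≤n 12≤m j≤3 overloads-3×12
    loses (inj₂ (inj₁ (4≤n , 8≤m))) j≤3 = overloads-alice n m 4≤n 8≤m j≤3 overloads-4×8
    loses (inj₂ (inj₂ (5≤n , 6≤m))) j≤3 = overloads-alice n m 5≤n 6≤m j≤3 overloads-5×6

  a₁′-two : n ≡ 2 × m ≡ 2 → a₁′ G 2
  a₁′-two (n≡2 , m≡2) = smallest (bobStart (≤-reflexive n≡2) (≤-reflexive m≡2) scattered-2×2)
    λ j≤1 → overloads-bob n m 2≤n (≤-trans 2≤n n≤m) j≤1 overloads-bob-2×2

  a₁′-three : n ≡ 2 × 3 ≤ m → a₁′ G 3
  a₁′-three (n≡2 , 3≤m) = smallest (bobStart (≤-reflexive n≡2) ≤-refl (scattered-3 m))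
    λ j≤2 → overloads-bob n m 2≤n 3≤m j≤2 overloads-bob-2×3

  a₁′-four : 3 ≤ n → a₁′ G 4
  a₁′-four 3≤n = smallest (bobStart ≤-refl ≤-refl (scattered-4 n m))
    λ j≤3 → overloads-bob n m 3≤n (≤-trans 3≤n n≤m) j≤3 overloads-bob-3×3
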